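{- For every integer $r \geq 3$ there exists a constant $\mu_r>0$ such that for all $\alpha>0$ and $\varepsilon>0$, \[ \delta\left(\varepsilon, K_r; \frac{2r-5}{2r-3}+\alpha\right) \geq \mu_r \alpha \varepsilon . \] In other words, every $n$-vertex graph $G$ with minimum degree at least $\left(\frac{2r-5}{2r-3}+\alpha\right)n$ and fewer than $\mu_r\alpha\varepsilon n^r$ copies of $K_r$ can be made $K_r$-free by deleting at most $\varepsilon n^2$ edges.
   Context: For a graph $H$ on $h$ vertices, $\varepsilon>0$ and $\gamma\in[0,1]$, $\delta(\varepsilon,H;\gamma)$ denotes the maximum $\delta\in[0,1]$ such that, for every $n$, every $n$-vertex graph with fewer than $\delta n^h$ copies of $H$ (subgraphs isomorphic to $H$) and minimum degree at least $\gamma n$ can be made $H$-free by deleting at most $\varepsilon n^2$ edges. $K_r$ denotes the complete graph on $r$ vertices. -}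

module Defs where

open import Data.Bool using (Bool; true; false; _∧_; _∨_; not; if_then_else_)
open import Data.Nat as ℕ using (ℕ; zero; suc; _<ᵇ_; _≡ᵇ_)
import Data.Nat.Properties as ℕₚ
open import Data.Fin using (Fin; toℕ)
open import Data.Fin.Properties using (_≟_)
open import Data.Vec using (Vec; []; _∷_; lookup)
open import Data.List using (List; []; _∷_; [_]; map; _++_; length; filterᵇ; allFin)
open import Data.Nat.ListAction using (sum)
open import Data.Bool.ListAction using (all)
open import Data.Integer using (+_)
open import Data.Rational using (ℚ; _/_)
open import Relation.Nullary.Decidable using (⌊_⌋)
open import Relation.Binary.PropositionalEquality using (_≡_)

record Graph (n : ℕ) : Set where
  field
    adj    : Fin n → Fin n → Bool
    sym    : ∀ i j → adj i j ≡ adj j i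
    irrefl : ∀ i → adj i i ≡ false
open Graph public

_⊆G_ : ∀ {n} → Graph n → Graph n → Set
H ⊆G G = ∀ i j → adj H i j ≡ true → adj G i j ≡ true

degree : ∀ {n} → Graph n → Fin n → ℕ
degree {n} G v = length (filterᵇ (adj G v) (allFin n))

removedEdges : ∀ {n} → Graph n → Graph n → ℕ
removedEdges {n} G H =
  sum (map (λ i → length (filterᵇ (λ j → (toℕ i <ᵇ toℕ j) ∧ adj G i j ∧ not (adj H i j)) (allFin n)))
           (allFin n))

allSubsets : (n : ℕ) → List (Vec Bool n)
allSubsets zero    = [ [] ]
allSubsets (suc n) = map (false ∷_) (allSubsets n) ++ map (true ∷_) (allSubsets n)

card : ∀ {n} → Vec Bool n → ℕ
card []           = 0
card (false ∷ xs) = card xs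
card (true ∷ xs)  = suc (card xs)

isClique : ∀ {n} → Graph n → Vec Bool n → Bool
isClique {n} G S =
  all (λ i → all (λ j → not (lookup S i ∧ lookup S j ∧ not ⌊ i ≟ j ⌋) ∨ adj G i j) (allFin n)) (allFin n)

copiesK : ∀ {n} → Graph n → ℕ → ℕ
copiesK {n} G r = length (filterᵇ (λ S → (card S ≡ᵇ r) ∧ isClique G S) (allSubsets n))

ℕtoℚ : ℕ → ℚ
ℕtoℚ m = + m / 1

-- the threshold (2r-5)/(2r-3), for r ≥ 3 (r = 3 + k gives (2k+1)/(2k+3));
-- value for r < 3 is irrelevant (the theorem assumes r ≥ 3)
threshold : ℕ → ℚ
threshold (suc (suc (suc k))) = + (1 ℕ.+ 2 ℕ.* k) / (3 ℕ.+ 2 ℕ.* k)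
threshold _ = + 0 / 1

{-# OPTIONS --safe #-}
module Submission where

-- Write s = 2r - 3, so that every vertex has at most (2/s - α) n non-neighbours. Let A ∪ X be
-- an r-set with A a clique on p ≥ 3 vertices. Counting non-neighbours of vertices of X twice and
-- those of vertices of A once gives a total at most (2r - p)(2/s - α) n, which leaves at least αn
-- vertices (if p = 3), resp. n/s vertices (if p ≥ 4), adjacent to all of X and to all but at most
-- one vertex of A. Moving such a vertex into X and dropping its non-neighbour from A, and
-- iterating from A = K_r, X = ∅ until A is a single edge, shows that every K_r has an edge lying
-- in Ω(α n^(r-2)) copies of K_r. Deleting all edges with that property destroys every K_r, and by
-- double counting there are O(#K_r / (α n^(r-2))) of them.

open import Defs hiding (sym)
open import Data.Nat as ℕ using (ℕ; zero; suc; NonZero; _≤_; _<_; _^_; z≤n; s≤s; s≤s⁻¹; _≤?_; _≤ᵇ_; _≡ᵇ_; _<ᵇ_)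
import Data.Nat.Properties as ℕₚ
open import Data.Nat.ListAction using (sum)
open import Data.Nat.Tactic.RingSolver using (solve-∀)
open import Data.Bool using (T?; Bool; true; false; _∧_; _∨_; not; if_then_else_)
open import Data.Bool.Properties using (∨-comm; ∧-identityʳ; T-≡; ¬-not)
open import Data.Bool.ListAction using (all)
open import Data.Fin as Fin using (Fin; toℕ)
open import Data.Fin.Properties using (_≟_)
open import Data.Vec as Vec using (Vec; lookup; replicate; _[_]≔_)
open import Data.Vec.Properties using (lookup∘update; lookup∘update′; lookup-replicate)
open import Data.List using (List; []; _∷_; map; _++_; length; filterᵇ; allFin)
open import Data.List.Properties using (map-tabulate; length-tabulate)
open import Data.List.Membership.Propositional using (_∈_)
open import Data.List.Membership.Propositional.Properties using (∈-allFin; ∈-++⁺ˡ; ∈-++⁺ʳ; ∈-map⁺; ∈-++⁻)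
open import Data.List.Relation.Unary.All as All using (All; []; _∷_)
open import Data.List.Relation.Unary.Any using (here; there)
open import Data.List.Relation.Unary.AllPairs as AllPairs using (AllPairs; []; _∷_)
open import Data.List.Relation.Unary.Unique.Propositional using (Unique)
open import Data.List.Relation.Unary.Unique.Propositional.Properties using (allFin⁺; filter⁺)
open import Data.List.Relation.Binary.Sublist.Propositional as Sublist using (_⊆_; []; _∷_; _∷ʳ_; ⊆-refl)
open import Data.Product using (_×_; ∃-syntax; _,_; proj₁; proj₂)
open import Data.Empty using (⊥; ⊥-elim)
open import Data.Sum using (_⊎_; inj₁; inj₂)
open import Function using (_∘_; id; Equivalence)
open import Relation.Nullary using (yes; no; contradiction)
open import Relation.Nullary.Decidable using (⌊_⌋)
open import Relation.Binary.PropositionalEquality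
  using (_≡_; _≢_; refl; sym; trans; cong; cong₂; subst; subst₂; module ≡-Reasoning)

module _ where

  open import Data.Nat using (_+_; _*_)

  -- Finite sums

  ∑ : {A : Set} → List A → (A → ℕ) → ℕ
  ∑ xs f = sum (map f xs)

  syntax ∑ xs (λ x → e) = ∑[ x ∈ xs ] e
  infix 5 ∑

  𝟙 : Bool → ℕ
  𝟙 b = if b then 1 else 0

  module _ {A : Set} where

    ∑-mono-∈ : {f g : A → ℕ} (xs : List A) → (∀ {x} → x ∈ xs → f x ≤ g x) → ∑ xs f ≤ ∑ xs g
    ∑-mono-∈ []       f≤g = z≤n
    ∑-mono-∈ (x ∷ xs) f≤g = ℕₚ.+-mono-≤ (f≤g (here refl)) (∑-mono-∈ xs (f≤g ∘ there))

    ∑-mono : {f g : A → ℕ} (xs : List A) → (∀ x → f x ≤ g x) → ∑ xs f ≤ ∑ xs g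
    ∑-mono xs f≤g = ∑-mono-∈ xs (λ {x} _ → f≤g x)

    ∑-cong : {f g : A → ℕ} (xs : List A) → (∀ x → f x ≡ g x) → ∑ xs f ≡ ∑ xs g
    ∑-cong []       f≡g = refl
    ∑-cong (x ∷ xs) f≡g = cong₂ _+_ (f≡g x) (∑-cong xs f≡g)

    ∑-const : (xs : List A) (c : ℕ) → ∑ xs (λ _ → c) ≡ length xs * c
    ∑-const []       c = refl
    ∑-const (x ∷ xs) c = cong (c +_) (∑-const xs c)

    ∑-distrib-+ : (xs : List A) (f g : A → ℕ) → ∑ xs (λ x → f x + g x) ≡ ∑ xs f + ∑ xs g
    ∑-distrib-+ []       f g = refl
    ∑-distrib-+ (x ∷ xs) f g =
      trans (cong (f x + g x +_) (∑-distrib-+ xs f g)) (interchange (f x) (g x) (∑ xs f) (∑ xs g))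
      where
      interchange : ∀ a b c d → a + b + (c + d) ≡ a + c + (b + d)
      interchange = solve-∀

    *-distribˡ-∑ : (c : ℕ) (xs : List A) (f : A → ℕ) → c * ∑ xs f ≡ ∑ xs (λ x → c * f x)
    *-distribˡ-∑ c []       f = ℕₚ.*-zeroʳ c
    *-distribˡ-∑ c (x ∷ xs) f =
      trans (ℕₚ.*-distribˡ-+ c (f x) (∑ xs f)) (cong (c * f x +_) (*-distribˡ-∑ c xs f))

    *-distribʳ-∑ : (c : ℕ) (xs : List A) (f : A → ℕ) → ∑ xs f * c ≡ ∑ xs (λ x → f x * c)
    *-distribʳ-∑ c []       f = refl
    *-distribʳ-∑ c (x ∷ xs) f =
      trans (ℕₚ.*-distribʳ-+ c (f x) (∑ xs f)) (cong (f x * c +_) (*-distribʳ-∑ c xs f))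

    ∑-⊆ : {xs ys : List A} (f : A → ℕ) → xs ⊆ ys → ∑ xs f ≤ ∑ ys f
    ∑-⊆ f []             = z≤n
    ∑-⊆ f (y ∷ʳ xs⊆ys)   = ℕₚ.≤-trans (∑-⊆ f xs⊆ys) (ℕₚ.m≤n+m _ (f y))
    ∑-⊆ f (refl ∷ xs⊆ys) = ℕₚ.+-monoʳ-≤ (f _) (∑-⊆ f xs⊆ys)

    ∑-∈ : {xs : List A} {x : A} (f : A → ℕ) → x ∈ xs → f x ≤ ∑ xs f
    ∑-∈ f (here refl)              = ℕₚ.m≤m+n _ _
    ∑-∈ f (there {x = y} {xs} x∈xs) = ℕₚ.≤-trans (∑-∈ f x∈xs) (ℕₚ.m≤n+m _ (f y))

    -- The additive shape, free of subtraction and division, matches the bound on `nondegree` to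
    -- which it is applied.
    ∑-upper : (xs : List A) (f : A → ℕ) {a b c : ℕ} → (∀ x → a * f x + b ≤ c) →
              a * ∑ xs f + length xs * b ≤ length xs * c
    ∑-upper xs f {a} {b} {c} bound = begin
      a * ∑ xs f + length xs * b                ≡⟨ cong₂ _+_ (*-distribˡ-∑ a xs f) (sym (∑-const xs b)) ⟩
      ∑ xs (λ x → a * f x) + ∑ xs (λ _ → b)      ≡⟨ ∑-distrib-+ xs _ _ ⟨
      ∑ xs (λ x → a * f x + b)                   ≤⟨ ∑-mono xs bound ⟩
      ∑ xs (λ _ → c)                               ≡⟨ ∑-const xs c ⟩
      length xs * c                               ∎
      where open ℕₚ.≤-Reasoning

    -- If the head falls short of `c`, the tail still averages at least `c`. The descent ends at a
    -- singleton, which cannot fall short.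
    ∑-average : (xs : List A) (f : A → ℕ) (c : ℕ) → 0 < length xs → length xs * c ≤ ∑ xs f →
                ∃[ x ] x ∈ xs × c ≤ f x
    ∑-average (x ∷ xs) f c _ le with c ≤? f x
    ... | yes c≤fx = x , here refl , c≤fx
    ∑-average (x ∷ []) f c _ le | no c≰fx =
      contradiction (ℕₚ.+-cancelʳ-≤ 0 c (f x) le) c≰fx
    ∑-average (x ∷ xs@(_ ∷ _)) f c _ le | no c≰fx
      with y , y∈xs , c≤fy ← ∑-average xs f c (s≤s z≤n)
             (ℕₚ.+-cancelˡ-≤ c _ _ (ℕₚ.≤-trans le (ℕₚ.+-monoˡ-≤ _ (ℕₚ.<⇒≤ (ℕₚ.≰⇒> c≰fx)))))
      = y , there y∈xs , c≤fy

    length-filterᵇ : (p : A → Bool) (xs : List A) → length (filterᵇ p xs) ≡ ∑ xs (𝟙 ∘ p)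
    length-filterᵇ p []       = refl
    length-filterᵇ p (x ∷ xs) with p x
    ... | true  = cong suc (length-filterᵇ p xs)
    ... | false = length-filterᵇ p xs

    filterᵇ-∈⁺ : (p : A → Bool) {x : A} {xs : List A} → x ∈ xs → p x ≡ true → x ∈ filterᵇ p xs
    filterᵇ-∈⁺ p {xs = y ∷ _} (here refl) px with p y
    ... | true  = here refl
    filterᵇ-∈⁺ p {xs = y ∷ _} (there x∈xs) px with p y
    ... | true  = there (filterᵇ-∈⁺ p x∈xs px)
    ... | false = filterᵇ-∈⁺ p x∈xs px

    filterᵇ-∈⁻ : (p : A → Bool) {x : A} (xs : List A) → x ∈ filterᵇ p xs → p x ≡ true
    filterᵇ-∈⁻ p (y ∷ ys) x∈ with p y in py
    ... | false = filterᵇ-∈⁻ p ys x∈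
    filterᵇ-∈⁻ p (y ∷ ys) (here refl) | true = py
    filterᵇ-∈⁻ p (y ∷ ys) (there x∈)  | true = filterᵇ-∈⁻ p ys x∈

    all-true⁺ : (p : A → Bool) (xs : List A) → (∀ {x} → x ∈ xs → p x ≡ true) → all p xs ≡ true
    all-true⁺ p []       h = refl
    all-true⁺ p (x ∷ xs) h rewrite h (here refl) = all-true⁺ p xs (h ∘ there)

    all-true⁻ : (p : A → Bool) (xs : List A) → all p xs ≡ true → ∀ {x} → x ∈ xs → p x ≡ true
    all-true⁻ p (x ∷ xs) h x∈ with p x in px
    all-true⁻ p (x ∷ xs) h (here refl) | true = px
    all-true⁻ p (x ∷ xs) h (there x∈)  | true = all-true⁻ p xs h x∈

    AllPairs-⊆ : {R : A → A → Set} {xs ys : List A} → xs ⊆ ys → AllPairs R ys → AllPairs R xs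
    AllPairs-⊆ []             []         = []
    AllPairs-⊆ (y ∷ʳ xs⊆ys)   (_ ∷ rest) = AllPairs-⊆ xs⊆ys rest
    AllPairs-⊆ (refl ∷ xs⊆ys) (r ∷ rest) =
      All.tabulate (λ x∈ → All.lookup r (Sublist.lookup xs⊆ys x∈)) ∷ AllPairs-⊆ xs⊆ys rest

  ∑-swap : {A B : Set} (xs : List A) (ys : List B) (f : A → B → ℕ) →
           ∑ xs (λ x → ∑ ys (f x)) ≡ ∑ ys (λ y → ∑ xs (λ x → f x y))
  ∑-swap []       ys f = sym (trans (∑-const ys 0) (ℕₚ.*-zeroʳ (length ys)))
  ∑-swap (x ∷ xs) ys f =
    trans (cong (∑ ys (f x) +_) (∑-swap xs ys f)) (sym (∑-distrib-+ ys (f x) _))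

  ∑-allFin-suc : ∀ {n} (f : Fin (suc n) → ℕ) →
                 ∑ (allFin (suc n)) f ≡ f Fin.zero + ∑ (allFin n) (f ∘ Fin.suc)
  ∑-allFin-suc f =
    cong (λ xs → f Fin.zero + sum xs)
      (trans (map-tabulate Fin.suc f) (sym (map-tabulate id (f ∘ Fin.suc))))

  length-allFin : ∀ n → length (allFin n) ≡ n
  length-allFin n = length-tabulate id

  -- Every K_r has an edge in many copies of K_r

  module _ {n : ℕ} (G : Graph n) where

    -- The number of sequences y₁, …, y_k in which every y_i is adjacent to all of X and to all
    -- earlier y_j.
    extensions : List (Fin n) → ℕ → ℕ
    extensions X zero    = 1
    extensions X (suc k) = ∑[ y ∈ allFin n ] 𝟙 (all (adj G y) X) * extensions (y ∷ X) k

    -- The edge stands behind `X`, so that `(y ∷ X) ++ a ∷ b ∷ []` and `y ∷ (X ++ a ∷ b ∷ [])` agree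
    -- by computation: moving `y` into `X` is the same as choosing `y` as the first extending
    -- vertex.
    edgeExtensions : List (Fin n) → ℕ → Fin n → Fin n → ℕ
    edgeExtensions X k a b = 𝟙 (adj G a b) * extensions (X ++ a ∷ b ∷ []) k

    -- Edges inside `A` are counted in both orientations; the diagonal contributes 0 because `G` has
    -- no loops.
    totalExtensions : List (Fin n) → List (Fin n) → ℕ → ℕ
    totalExtensions A X k = ∑[ a ∈ A ] ∑[ b ∈ A ] edgeExtensions X k a b

    -- Non-neighbours and good vertices

    nonadj : Fin n → Fin n → ℕ
    nonadj x y = 𝟙 (not (adj G x y))

    -- The vertex `x` itself is included, which makes degree and nondegree add up to exactly `n`.
    nondegree : Fin n → ℕ
    nondegree x = ∑ (allFin n) (nonadj x)

    degree+nondegree : ∀ x → degree G x + nondegree x ≡ n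
    degree+nondegree x = begin
      degree G x + nondegree x                                ≡⟨ cong (_+ nondegree x) (length-filterᵇ (adj G x) (allFin n)) ⟩
      ∑ (allFin n) (𝟙 ∘ adj G x) + ∑ (allFin n) (nonadj x)    ≡⟨ ∑-distrib-+ (allFin n) _ _ ⟨
      ∑ (allFin n) (λ y → 𝟙 (adj G x y) + nonadj x y)         ≡⟨ ∑-cong (allFin n) (λ y → 𝟙-complement (adj G x y)) ⟩
      ∑ (allFin n) (λ _ → 1)                                  ≡⟨ ∑-const (allFin n) 1 ⟩
      length (allFin n) * 1                                   ≡⟨ ℕₚ.*-identityʳ _ ⟩
      length (allFin n)                                       ≡⟨ length-allFin n ⟩
      n                                                       ∎
      where
      open ≡-Reasoning
      𝟙-complement : ∀ b → 𝟙 b + 𝟙 (not b) ≡ 1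
      𝟙-complement true  = refl
      𝟙-complement false = refl

    adjacent-to-all : ∀ y X → ∑ X (λ x → nonadj x y) ≡ 0 → ∀ {x} → x ∈ X → adj G y x ≡ true
    adjacent-to-all y (x ∷ X) none x∈ with adj G x y in xy
    adjacent-to-all y (x ∷ X) none (here refl) | true = trans (Graph.sym G y x) xy
    adjacent-to-all y (x ∷ X) none (there x∈)  | true = adjacent-to-all y X none x∈

    -- The first non-neighbour of `y` is dropped, and it uses up the whole allowance. If `y` lies in
    -- `A`, then it is its own non-neighbour and is the vertex dropped.
    adjacent-to-all-but-one : ∀ y A p → length A ≡ suc p → ∑ A (λ a → nonadj a y) ≤ 1 →
      ∃[ A′ ] A′ ⊆ A × length A′ ≡ p × (∀ {a} → a ∈ A′ → adj G y a ≡ true)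
    adjacent-to-all-but-one y (a ∷ A) p |A| few with adj G a y in ay
    adjacent-to-all-but-one y (a ∷ A) p |A| few | false =
      A , a ∷ʳ ⊆-refl , ℕₚ.suc-injective |A| ,
      adjacent-to-all y A (ℕₚ.n≤0⇒n≡0 (s≤s⁻¹ few))
    -- No non-neighbour has turned up, so the last vertex is dropped to make the length exactly `p`.
    adjacent-to-all-but-one y (a ∷ [])        zero    |A| few | true = [] , a ∷ʳ [] , refl , λ ()
    adjacent-to-all-but-one y (a ∷ A@(_ ∷ _)) (suc p) |A| few | true
      with A′ , A′⊆A , |A′| , y~A′ ← adjacent-to-all-but-one y A p (ℕₚ.suc-injective |A|) few
      = a ∷ A′ , refl ∷ A′⊆A , cong suc |A′| ,
        λ { (here refl) → trans (Graph.sym G y a) ay ; (there a∈) → y~A′ a∈ }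

    -- With the factor 2, one non-neighbour in `X` already disqualifies `y`, whereas one in `A` is
    -- tolerated. Averaging this single number handles both conditions at once.
    weight : List (Fin n) → List (Fin n) → Fin n → ℕ
    weight A X y = 2 * ∑ X (λ x → nonadj x y) + ∑ A (λ a → nonadj a y)

    -- Weight at most 1 means: adjacent to all of X and to all but at most one vertex of A.
    good : List (Fin n) → List (Fin n) → Fin n → Bool
    good A X y = weight A X y <ᵇ 2

    goodCount : List (Fin n) → List (Fin n) → ℕ
    goodCount A X = ∑ (allFin n) (𝟙 ∘ good A X)

    totalWeight : ∀ A X → ∑ (allFin n) (weight A X) ≡ 2 * ∑ X nondegree + ∑ A nondegree
    totalWeight A X = begin
      ∑ (allFin n) (weight A X)
        ≡⟨ ∑-distrib-+ (allFin n) _ _ ⟩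
      ∑ (allFin n) (λ y → 2 * ∑ X (λ x → nonadj x y)) + ∑ (allFin n) (λ y → ∑ A (λ a → nonadj a y))
        ≡⟨ cong₂ _+_ (*-distribˡ-∑ 2 (allFin n) _) (∑-swap A (allFin n) nonadj) ⟨
      2 * ∑ (allFin n) (λ y → ∑ X (λ x → nonadj x y)) + ∑ A nondegree
        ≡⟨ cong (λ t → 2 * t + ∑ A nondegree) (∑-swap X (allFin n) nonadj) ⟨
      2 * ∑ X nondegree + ∑ A nondegree
        ∎
      where
      open ≡-Reasoning

    -- Each vertex contributes at least 2 on the right: a good one through the first term, any other
    -- through its weight.
    2n≤goodCount+totalWeight : ∀ A X → 2 * n ≤ 2 * goodCount A X + ∑ (allFin n) (weight A X)
    2n≤goodCount+totalWeight A X = begin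
      2 * n                                                       ≡⟨ ℕₚ.*-comm 2 n ⟩
      n * 2                                                       ≡⟨ cong (_* 2) (length-allFin n) ⟨
      length (allFin n) * 2                                       ≡⟨ ∑-const (allFin n) 2 ⟨
      ∑ (allFin n) (λ _ → 2)                                      ≤⟨ ∑-mono (allFin n) (λ y → threshold-2 (weight A X y)) ⟩
      ∑ (allFin n) (λ y → 2 * 𝟙 (good A X y) + weight A X y)      ≡⟨ ∑-distrib-+ (allFin n) _ _ ⟩
      ∑ (allFin n) (λ y → 2 * 𝟙 (good A X y)) + ∑ (allFin n) (weight A X)
        ≡⟨ cong (_+ ∑ (allFin n) (weight A X)) (*-distribˡ-∑ 2 (allFin n) _) ⟨
      2 * goodCount A X + ∑ (allFin n) (weight A X)               ∎
      where
      open ℕₚ.≤-Reasoning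
      threshold-2 : ∀ w → 2 ≤ 2 * 𝟙 (w <ᵇ 2) + w
      threshold-2 0             = s≤s (s≤s z≤n)
      threshold-2 1             = s≤s (s≤s z≤n)
      threshold-2 (suc (suc w)) = s≤s (s≤s z≤n)

    -- The first extending vertex is summed outermost, so that the contribution of each good vertex
    -- can be bounded separately.
    totalExtensions-suc : ∀ A X k → totalExtensions A X (suc k) ≡
      ∑[ y ∈ allFin n ] ∑[ a ∈ A ] ∑[ b ∈ A ]
        𝟙 (adj G a b) * (𝟙 (all (adj G y) (X ++ a ∷ b ∷ [])) * extensions (y ∷ X ++ a ∷ b ∷ []) k)
    totalExtensions-suc A X k =
      trans (∑-cong A λ a → trans (∑-cong A λ b → *-distribˡ-∑ (𝟙 (adj G a b)) (allFin n) _)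
                                  (∑-swap A (allFin n) _))
            (∑-swap A (allFin n) _)

    -- Swapping one vertex of A for a good vertex y of X keeps |A| + |X| fixed.
    totalExtensions-step : ∀ A X p k c T → length A ≡ suc p →
      (∀ A′ y → A′ ⊆ A → length A′ ≡ p → T ≤ c * totalExtensions A′ (y ∷ X) k) →
      goodCount A X * T ≤ c * totalExtensions A X (suc k)
    totalExtensions-step A X p k c T |A| IH = begin
      goodCount A X * T                                ≡⟨ *-distribʳ-∑ T (allFin n) _ ⟩
      ∑ (allFin n) (λ y → 𝟙 (good A X y) * T)          ≤⟨ ∑-mono (allFin n) perVertex ⟩
      ∑ (allFin n) (λ y → c * through y)               ≡⟨ *-distribˡ-∑ c (allFin n) _ ⟨
      c * ∑ (allFin n) through                         ≡⟨ cong (c *_) (totalExtensions-suc A X k) ⟨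
      c * totalExtensions A X (suc k)                  ∎
      where
      open ℕₚ.≤-Reasoning
      term : Fin n → Fin n → Fin n → ℕ
      term y a b = 𝟙 (adj G a b) * (𝟙 (all (adj G y) (X ++ a ∷ b ∷ [])) * extensions (y ∷ X ++ a ∷ b ∷ []) k)

      through : Fin n → ℕ
      through y = ∑[ a ∈ A ] ∑[ b ∈ A ] term y a b

      few-X : ∀ s t → 2 * s + t < 2 → s ≡ 0
      few-X zero    t _  = refl
      few-X (suc s) t lt = contradiction lt (ℕₚ.≤⇒≯ (ℕₚ.≤-trans (ℕₚ.*-monoʳ-≤ 2 (s≤s z≤n)) (ℕₚ.m≤m+n _ t)))

      perVertex : ∀ y → 𝟙 (good A X y) * T ≤ c * through y
      perVertex y with good A X y in gy
      ... | false = z≤n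
      ... | true
        with w<2 ← ℕₚ.<ᵇ⇒< (weight A X y) 2 (Equivalence.from T-≡ gy)
        with A′ , A′⊆A , |A′| , y~A′ ←
               adjacent-to-all-but-one y A p |A| (ℕₚ.≤-trans (ℕₚ.m≤n+m _ _) (s≤s⁻¹ w<2))
        = begin
          1 * T                                           ≡⟨ ℕₚ.*-identityˡ T ⟩
          T                                               ≤⟨ IH A′ y A′⊆A |A′| ⟩
          -- On pairs from `A′` the indicator in `term` is 1, as `y` is adjacent to all of `X` and
          -- `A′`; passing from `A′` back to `A` only adds terms.
          c * totalExtensions A′ (y ∷ X) k                ≤⟨ ℕₚ.*-monoʳ-≤ c (∑-mono-∈ A′ λ a∈ → ∑-mono-∈ A′ λ b∈ → ℕₚ.≤-reflexive (edge a∈ b∈)) ⟩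
          c * ∑ A′ (λ a → ∑ A′ (λ b → term y a b))        ≤⟨ ℕₚ.*-monoʳ-≤ c (∑-mono A′ λ a → ∑-⊆ (term y a) A′⊆A) ⟩
          c * ∑ A′ (λ a → ∑ A (λ b → term y a b))         ≤⟨ ℕₚ.*-monoʳ-≤ c (∑-⊆ _ A′⊆A) ⟩
          c * through y                                   ∎
        where
        edge : ∀ {a b} → a ∈ A′ → b ∈ A′ → edgeExtensions (y ∷ X) k a b ≡ term y a b
        edge {a} {b} a∈ b∈ = cong (𝟙 (adj G a b) *_) (sym (trans (cong (λ t → 𝟙 t * e) y~) (ℕₚ.*-identityˡ e)))
          where
          e = extensions (y ∷ X ++ a ∷ b ∷ []) k
          y~ : all (adj G y) (X ++ a ∷ b ∷ []) ≡ true
          y~ = all-true⁺ (adj G y) (X ++ a ∷ b ∷ []) λ x∈ → case-∈ (∈-++⁻ X x∈)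
            where
            case-∈ : ∀ {x} → x ∈ X ⊎ x ∈ a ∷ b ∷ [] → adj G y x ≡ true
            case-∈ (inj₁ x∈)                 = adjacent-to-all y X (few-X _ _ w<2) x∈
            case-∈ (inj₂ (here refl))         = y~A′ a∈
            case-∈ (inj₂ (there (here refl))) = y~A′ b∈

    -- `bound` is `nondegree x ≤ (2/s - u/v) n` multiplied by `s v`, with `u/v` in the role of α.
    module _ (s u v : ℕ) .{{_ : NonZero v}}
             (bound : ∀ x → s * v * nondegree x + u * s * n ≤ 2 * v * n) where

      -- With `m = 2k + 3 + p` the total weight is at most `m (2/s - u/v) n`. Since `s - m = p`,
      -- twice the good count is at least `2pn/s + m (u/v) n`; the statement is this times `s v`.
      many-good : ∀ p k A X → length A ≡ 3 + p → length X ≡ k → s ≡ 3 + 2 * p + 2 * k →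
        2 * p * v * n + (2 * k + (3 + p)) * (u * s * n) ≤ 2 * s * v * goodCount A X
      -- Adding `m * (2 * v * n)` to both sides avoids subtraction.
      many-good p k A X refl-A refl s≡ = ℕₚ.+-cancelʳ-≤ ((2 * k + (3 + p)) * (2 * v * n)) _ _ (begin
        2 * p * v * n + m * (u * s * n) + m * (2 * v * n)
          ≡⟨ regroup p k v n (u * s * n) ⟩
        (3 + 2 * p + 2 * k) * v * (2 * n) + m * (u * s * n)
          ≡⟨ cong (λ t → t * v * (2 * n) + m * (u * s * n)) s≡ ⟨
        s * v * (2 * n) + m * (u * s * n)
          ≤⟨ ℕₚ.+-monoˡ-≤ _ (ℕₚ.*-monoʳ-≤ (s * v) (2n≤goodCount+totalWeight A X)) ⟩
        s * v * (2 * goodCount A X + ∑ (allFin n) (weight A X)) + m * (u * s * n)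
          ≡⟨ cong (λ t → s * v * (2 * goodCount A X + t) + m * (u * s * n)) (totalWeight A X) ⟩
        s * v * (2 * goodCount A X + (2 * ∑ X nondegree + ∑ A nondegree)) + m * (u * s * n)
          ≡⟨ expand k (3 + p) s v (goodCount A X) (∑ X nondegree) (∑ A nondegree) (u * s * n) ⟩
        2 * s * v * goodCount A X + (2 * (s * v * ∑ X nondegree + k * (u * s * n)) + (s * v * ∑ A nondegree + (3 + p) * (u * s * n)))
          ≤⟨ ℕₚ.+-monoʳ-≤ (2 * s * v * goodCount A X)
               (ℕₚ.+-mono-≤ (ℕₚ.*-monoʳ-≤ 2 (∑-upper X nondegree {s * v} {u * s * n} bound))
                            (subst (λ l → s * v * ∑ A nondegree + l * (u * s * n) ≤ l * (2 * v * n)) refl-A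
                                   (∑-upper A nondegree {s * v} {u * s * n} bound))) ⟩
        2 * s * v * goodCount A X + (2 * (k * (2 * v * n)) + (3 + p) * (2 * v * n))
          ≡⟨ collect k (3 + p) (2 * s * v * goodCount A X) (2 * v * n) ⟩
        2 * s * v * goodCount A X + m * (2 * v * n)
          ∎)
        where
        open ℕₚ.≤-Reasoning
        m = 2 * k + (3 + p)
        regroup : ∀ p k v n z → 2 * p * v * n + (2 * k + (3 + p)) * z + (2 * k + (3 + p)) * (2 * v * n)
                  ≡ (3 + 2 * p + 2 * k) * v * (2 * n) + (2 * k + (3 + p)) * z
        regroup = solve-∀
        expand : ∀ k p s v g x a z → s * v * (2 * g + (2 * x + a)) + (2 * k + p) * z
                 ≡ 2 * s * v * g + (2 * (s * v * x + k * z) + (s * v * a + p * z))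
        expand = solve-∀
        collect : ∀ k p g z → g + (2 * (k * z) + p * z) ≡ g + (2 * k + p) * z
        collect = solve-∀

      -- At `p = 0` only the α term survives. There `m = s`, which gives `s u n / 2v` good vertices,
      -- and `s ≥ 3` absorbs the 2.
      many-good-triangle : ∀ k A X → length A ≡ 3 → length X ≡ k → s ≡ 3 + 2 * k →
        u * n ≤ v * goodCount A X
      many-good-triangle k A X |A| |X| refl = ℕₚ.*-cancelˡ-≤ (2 * s) (begin
        2 * s * (u * n)                       ≤⟨ ℕₚ.m≤m+n _ _ ⟩
        2 * s * (u * n) + (1 + 2 * k) * (s * (u * n))  ≡⟨ regroup k u n ⟩
        (2 * k + 3) * (u * s * n)             ≤⟨ many-good 0 k A X |A| |X| refl ⟩
        2 * s * v * goodCount A X             ≡⟨ ℕₚ.*-assoc (2 * s) v _ ⟩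
        2 * s * (v * goodCount A X)           ∎)
        where
        open ℕₚ.≤-Reasoning
        regroup : ∀ k u n → 2 * (3 + 2 * k) * (u * n) + (1 + 2 * k) * ((3 + 2 * k) * (u * n))
                  ≡ (2 * k + 3) * (u * (3 + 2 * k) * n)
        regroup = solve-∀

      -- Here the term without α suffices on its own. Only the swap out of a triangle costs a factor
      -- α, which is why the final bound is linear in α.
      many-good-large : ∀ p k A X → length A ≡ 4 + p → length X ≡ k → s ≡ 3 + 2 * suc p + 2 * k →
        n ≤ s * goodCount A X
      many-good-large p k A X |A| |X| s≡ = ℕₚ.*-cancelˡ-≤ (2 * v) {{ℕₚ.m*n≢0 2 v}} (begin
        2 * v * n                                   ≤⟨ ℕₚ.m≤m+n _ _ ⟩
        2 * v * n + 2 * p * v * n                   ≡⟨ regroup p v n ⟩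
        2 * suc p * v * n                           ≤⟨ ℕₚ.m≤m+n _ _ ⟩
        2 * suc p * v * n + _                       ≤⟨ many-good (suc p) k A X |A| |X| s≡ ⟩
        2 * s * v * goodCount A X                   ≡⟨ shuffle s v (goodCount A X) ⟩
        2 * v * (s * goodCount A X)                 ∎)
        where
        open ℕₚ.≤-Reasoning
        regroup : ∀ p v n → 2 * v * n + 2 * p * v * n ≡ 2 * (1 + p) * v * n
        regroup = solve-∀
        shuffle : ∀ s v g → 2 * s * v * g ≡ 2 * v * (s * g)
        shuffle = solve-∀

      -- Each swap lowers `p` and raises `k` by one, so `s` stays fixed. The first `p` swaps offer
      -- at least `n/s` vertices each, the last one at least `(u/v) n`.
      many-extensions : ∀ p k A X → length A ≡ 3 + p → length X ≡ k → s ≡ 3 + 2 * p + 2 * k →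
        AllPairs (λ a b → adj G a b ≡ true) A →
        u * n ^ suc p ≤ v * s ^ p * totalExtensions A X (suc p)
      many-extensions zero k A X |A| |X| s≡ clique = begin
        u * (n * 1)                              ≡⟨ cong (u *_) (ℕₚ.*-identityʳ n) ⟩
        u * n                                    ≤⟨ many-good-triangle k A X |A| |X| s≡ ⟩
        v * goodCount A X                        ≡⟨ cong (v *_) (ℕₚ.*-identityʳ _) ⟨
        v * (goodCount A X * 1)                  ≤⟨ ℕₚ.*-monoʳ-≤ v (totalExtensions-step A X 2 0 1 1 |A| edge) ⟩
        v * (1 * totalExtensions A X 1)          ≡⟨ ℕₚ.*-assoc v 1 _ ⟨
        v * 1 * totalExtensions A X 1            ∎
        where
        open ℕₚ.≤-Reasoning
        edge : ∀ A′ y → A′ ⊆ A → length A′ ≡ 2 → 1 ≤ 1 * totalExtensions A′ (y ∷ X) 0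
        -- Two vertices left over from a clique form an edge, and its empty extension counts 1.
        edge (a ∷ b ∷ []) y A′⊆A _ with (ab ∷ []) ∷ _ ← AllPairs-⊆ A′⊆A clique = begin
          1                                          ≡⟨ cong (λ t → 𝟙 t * 1) ab ⟨
          edgeExtensions (y ∷ X) 0 a b               ≤⟨ ∑-∈ {xs = a ∷ b ∷ []} (edgeExtensions (y ∷ X) 0 a) (there (here refl)) ⟩
          ∑ (a ∷ b ∷ []) (edgeExtensions (y ∷ X) 0 a)  ≤⟨ ∑-∈ {xs = a ∷ b ∷ []} (λ a′ → ∑ (a ∷ b ∷ []) (edgeExtensions (y ∷ X) 0 a′)) (here refl) ⟩
          totalExtensions (a ∷ b ∷ []) (y ∷ X) 0     ≡⟨ ℕₚ.*-identityˡ _ ⟨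
          1 * totalExtensions (a ∷ b ∷ []) (y ∷ X) 0 ∎
      many-extensions (suc p) k A X |A| |X| s≡ clique = begin
        u * (n * n ^ suc p)                      ≡⟨ shuffle₁ u n (n ^ suc p) ⟩
        n * (u * n ^ suc p)                      ≤⟨ ℕₚ.*-monoˡ-≤ _ (many-good-large p k A X |A| |X| s≡) ⟩
        s * goodCount A X * (u * n ^ suc p)      ≡⟨ ℕₚ.*-assoc s _ _ ⟩
        s * (goodCount A X * (u * n ^ suc p))    ≤⟨ ℕₚ.*-monoʳ-≤ s (totalExtensions-step A X (3 + p) (suc p) (v * s ^ p) _ |A| IH) ⟩
        s * (v * s ^ p * totalExtensions A X (suc (suc p)))  ≡⟨ shuffle₂ s v (s ^ p) _ ⟩
        v * (s * s ^ p) * totalExtensions A X (suc (suc p))  ∎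
        where
        open ℕₚ.≤-Reasoning
        IH : ∀ A′ y → A′ ⊆ A → length A′ ≡ 3 + p →
             u * n ^ suc p ≤ v * s ^ p * totalExtensions A′ (y ∷ X) (suc p)
        IH A′ y A′⊆A |A′| = many-extensions p (suc k) A′ (y ∷ X) |A′| (cong suc |X|)
                              (trans s≡ (move p k)) (AllPairs-⊆ A′⊆A clique)
          where
          move : ∀ p k → 3 + 2 * (1 + p) + 2 * k ≡ 3 + 2 * p + 2 * (1 + k)
          move = solve-∀
        shuffle₁ : ∀ u n t → u * (n * t) ≡ n * (u * t)
        shuffle₁ = solve-∀
        shuffle₂ : ∀ s v t w → s * (v * t * w) ≡ v * (s * t) * w
        shuffle₂ = solve-∀

  -- Subsets and cliques

  support : ∀ {n} → List (Fin n) → Vec Bool n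
  support {n} []  = replicate n false
  support (x ∷ X) = support X [ x ]≔ true

  lookup-support⁺ : ∀ {n} {x : Fin n} (X : List (Fin n)) → x ∈ X → lookup (support X) x ≡ true
  lookup-support⁺ (y ∷ X) (here refl) = lookup∘update y (support X) true
  lookup-support⁺ {x = x} (y ∷ X) (there x∈) with x ≟ y
  ... | yes refl = lookup∘update y (support X) true
  ... | no x≢y   = trans (lookup∘update′ x≢y (support X) true) (lookup-support⁺ X x∈)

  lookup-support⁻ : ∀ {n} {x : Fin n} (X : List (Fin n)) → lookup (support X) x ≡ true → x ∈ X
  lookup-support⁻ {x = x} []      eq = contradiction (trans (sym (lookup-replicate x false)) eq) λ ()
  lookup-support⁻ {x = x} (y ∷ X) eq with x ≟ y
  ... | yes refl = here refl
  ... | no x≢y   = there (lookup-support⁻ X (trans (sym (lookup∘update′ x≢y (support X) true)) eq))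

  card-insert : ∀ {n} (S : Vec Bool n) x → lookup S x ≡ false → card (S [ x ]≔ true) ≡ suc (card S)
  card-insert (false Vec.∷ S) Fin.zero    _  = refl
  card-insert (false Vec.∷ S) (Fin.suc x) eq = card-insert S x eq
  card-insert (true  Vec.∷ S) (Fin.suc x) eq = cong suc (card-insert S x eq)

  card-support : ∀ {n} (X : List (Fin n)) → Unique X → card (support X) ≡ length X
  card-support {n} []  _           = card-replicate n
    where
    card-replicate : ∀ n → card (replicate n false) ≡ 0
    card-replicate zero    = refl
    card-replicate (suc n) = card-replicate n
  card-support (x ∷ X) (x∉X ∷ X!) =
    trans (card-insert (support X) x (¬-not λ eq → All.lookup x∉X (lookup-support⁻ X eq) refl))
          (cong suc (card-support X X!))

  ∈-allSubsets : ∀ {n} (S : Vec Bool n) → S ∈ allSubsets n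
  ∈-allSubsets Vec.[]            = here refl
  ∈-allSubsets (false Vec.∷ S)   = ∈-++⁺ˡ (∈-map⁺ (false Vec.∷_) (∈-allSubsets S))
  ∈-allSubsets {suc n} (true Vec.∷ S) =
    ∈-++⁺ʳ (map (false Vec.∷_) (allSubsets n)) (∈-map⁺ (true Vec.∷_) (∈-allSubsets S))

  ∑-lookup : ∀ {n} (S : Vec Bool n) → ∑ (allFin n) (𝟙 ∘ lookup S) ≡ card S
  ∑-lookup Vec.[]              = refl
  ∑-lookup S@(false Vec.∷ S′) = trans (∑-allFin-suc (𝟙 ∘ lookup S)) (∑-lookup S′)
  ∑-lookup S@(true Vec.∷ S′)  = trans (∑-allFin-suc (𝟙 ∘ lookup S)) (cong suc (∑-lookup S′))

  elements : ∀ {n} → Vec Bool n → List (Fin n)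
  elements {n} S = filterᵇ (lookup S) (allFin n)

  length-elements : ∀ {n} (S : Vec Bool n) → length (elements S) ≡ card S
  length-elements {n} S = trans (length-filterᵇ (lookup S) (allFin n)) (∑-lookup S)

  isCliqueOfSize : ∀ {n} → Graph n → ℕ → Vec Bool n → Bool
  isCliqueOfSize G r S = (card S ≡ᵇ r) ∧ isClique G S

  cliques : ∀ {n} → Graph n → ℕ → List (Vec Bool n)
  cliques {n} G r = filterᵇ (isCliqueOfSize G r) (allSubsets n)

  ∧-true⁻ : ∀ {a b} → a ∧ b ≡ true → a ≡ true × b ≡ true
  ∧-true⁻ {true} {true} refl = refl , refl

  module _ {n : ℕ} (G : Graph n) where

    isClique⁺ : ∀ S → (∀ {i j} → lookup S i ≡ true → lookup S j ≡ true → i ≢ j → adj G i j ≡ true) →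
                isClique G S ≡ true
    isClique⁺ S h = all-true⁺ _ (allFin n) λ {i} _ → all-true⁺ _ (allFin n) λ {j} _ → pair i j
      where
      pair : ∀ i j → not (lookup S i ∧ lookup S j ∧ not ⌊ i ≟ j ⌋) ∨ adj G i j ≡ true
      pair i j with lookup S i in Si | lookup S j in Sj | i ≟ j
      ... | false | _     | _       = refl
      ... | true  | false | _       = refl
      ... | true  | true  | yes _   = refl
      ... | true  | true  | no i≢j  = h Si Sj i≢j

    isClique⁻ : ∀ S → isClique G S ≡ true →
                ∀ {i j} → lookup S i ≡ true → lookup S j ≡ true → i ≢ j → adj G i j ≡ true
    isClique⁻ S clique {i} {j} Si Sj i≢j = pair
      (all-true⁻ (λ k → not (lookup S i ∧ lookup S k ∧ not ⌊ i ≟ k ⌋) ∨ adj G i k) (allFin n)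
        (all-true⁻ (λ i → all (λ k → not (lookup S i ∧ lookup S k ∧ not ⌊ i ≟ k ⌋) ∨ adj G i k) (allFin n))
          (allFin n) clique (∈-allFin i)) (∈-allFin j))
      where
      pair : not (lookup S i ∧ lookup S j ∧ not ⌊ i ≟ j ⌋) ∨ adj G i j ≡ true → adj G i j ≡ true
      pair eq rewrite Si | Sj with i ≟ j
      ... | yes i≡j = contradiction i≡j i≢j
      ... | no _    = eq

    -- `isClique` only speaks of distinct vertices; filtering the duplicate-free `allFin n` keeps
    -- the entries distinct.
    elements-clique : ∀ S → isClique G S ≡ true → AllPairs (λ a b → adj G a b ≡ true) (elements S)
    elements-clique S clique = distinct⇒AllPairs (filter⁺ (T? ∘ lookup S) (allFin⁺ n))
      λ a∈ b∈ → isClique⁻ S clique (filterᵇ-∈⁻ (lookup S) (allFin n) a∈) (filterᵇ-∈⁻ (lookup S) (allFin n) b∈)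
      where
      distinct⇒AllPairs : ∀ {R : Fin n → Fin n → Set} {xs} → Unique xs →
        (∀ {x y} → x ∈ xs → y ∈ xs → x ≢ y → R x y) → AllPairs R xs
      distinct⇒AllPairs []        h = []
      distinct⇒AllPairs (x∉ ∷ xs!) h =
        All.tabulate (λ y∈ → h (here refl) (there y∈) (All.lookup x∉ y∈)) ∷
        distinct⇒AllPairs xs! (λ x∈ y∈ → h (there x∈) (there y∈))

    AllPairs-adj⇒adj : ∀ {X} → AllPairs (λ a b → adj G a b ≡ true) X →
                       ∀ {i j} → i ∈ X → j ∈ X → i ≢ j → adj G i j ≡ true
    AllPairs-adj⇒adj (x~ ∷ X~) (here refl) (here refl) i≢j = contradiction refl i≢j
    AllPairs-adj⇒adj (x~ ∷ X~) (here refl) (there j∈)  i≢j = All.lookup x~ j∈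
    AllPairs-adj⇒adj (x~ ∷ X~) {i} {j} (there i∈) (here refl) i≢j = trans (Graph.sym G i j) (All.lookup x~ i∈)
    AllPairs-adj⇒adj (x~ ∷ X~) (there i∈)  (there j∈)  i≢j = AllPairs-adj⇒adj X~ i∈ j∈ i≢j

    adj⇒≢ : ∀ {i j} → adj G i j ≡ true → i ≢ j
    adj⇒≢ {i} ij refl = contradiction (trans (sym ij) (irrefl G i)) λ ()

    -- Adjacent vertices are distinct, so the list has no repetition and its support has full
    -- cardinality.
    support-∈-cliques : ∀ {X} → AllPairs (λ a b → adj G a b ≡ true) X → support X ∈ cliques G (length X)
    support-∈-cliques {X} X~ = filterᵇ-∈⁺ (isCliqueOfSize G (length X)) (∈-allSubsets (support X))
      (cong₂ _∧_ (Equivalence.to T-≡ (ℕₚ.≡⇒≡ᵇ _ _ (card-support X (AllPairs.map adj⇒≢ X~))))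
        (isClique⁺ (support X) λ Si Sj → AllPairs-adj⇒adj X~ (lookup-support⁻ X Si) (lookup-support⁻ X Sj)))

    card-cliques : ∀ {r S} → S ∈ cliques G r → card S ≡ r
    card-cliques {r} {S} S∈ = ℕₚ.≡ᵇ⇒≡ (card S) r
      (Equivalence.from T-≡ (proj₁ (∧-true⁻ (filterᵇ-∈⁻ (isCliqueOfSize G r) (allSubsets n) S∈))))

    -- Each counted sequence completes `X` to a copy of K_r, and a copy `S` containing `X` arises at
    -- most `r ^ k` times. The count is crude: every new vertex ranges over all `r` vertices of `S`,
    -- including those already chosen.
    extensions-upper : ∀ r k X → length X + k ≡ r → AllPairs (λ a b → adj G a b ≡ true) X →
      extensions G X k ≤ (∑[ S ∈ cliques G r ] 𝟙 (all (lookup S) X)) * r ^ k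
    extensions-upper r zero X |X| X~ with refl ← trans (sym (ℕₚ.+-identityʳ _)) |X| = begin
      1                                                     ≡⟨ cong 𝟙 (all-true⁺ (lookup (support X)) X (lookup-support⁺ X)) ⟨
      𝟙 (all (lookup (support X)) X)                        ≤⟨ ∑-∈ (λ S → 𝟙 (all (lookup S) X)) (support-∈-cliques X~) ⟩
      ∑ (cliques G r) (λ S → 𝟙 (all (lookup S) X))          ≡⟨ ℕₚ.*-identityʳ _ ⟨
      ∑ (cliques G r) (λ S → 𝟙 (all (lookup S) X)) * 1      ∎
      where open ℕₚ.≤-Reasoning
    extensions-upper r (suc k) X |X| X~ = begin
      ∑ (allFin n) (λ y → 𝟙 (all (adj G y) X) * extensions G (y ∷ X) k)
        ≤⟨ ∑-mono (allFin n) perVertex ⟩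
      ∑ (allFin n) (λ y → ∑ (cliques G r) (λ S → 𝟙 (all (lookup S) (y ∷ X))) * r ^ k)
        ≡⟨ *-distribʳ-∑ (r ^ k) (allFin n) _ ⟨
      ∑ (allFin n) (λ y → ∑ (cliques G r) (λ S → 𝟙 (all (lookup S) (y ∷ X)))) * r ^ k
        ≡⟨ cong (_* r ^ k) (∑-swap (allFin n) (cliques G r) _) ⟩
      ∑ (cliques G r) (λ S → ∑ (allFin n) (λ y → 𝟙 (all (lookup S) (y ∷ X)))) * r ^ k
        ≤⟨ ℕₚ.*-monoˡ-≤ (r ^ k) (∑-mono-∈ (cliques G r) λ {S} S∈ → ℕₚ.≤-reflexive (perClique S S∈)) ⟩
      ∑ (cliques G r) (λ S → r * 𝟙 (all (lookup S) X)) * r ^ k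
        ≡⟨ cong (_* r ^ k) (*-distribˡ-∑ r (cliques G r) _) ⟨
      r * ∑ (cliques G r) (λ S → 𝟙 (all (lookup S) X)) * r ^ k
        ≡⟨ shuffle r (∑ (cliques G r) (λ S → 𝟙 (all (lookup S) X))) (r ^ k) ⟩
      ∑ (cliques G r) (λ S → 𝟙 (all (lookup S) X)) * (r * r ^ k)
        ∎
      where
      open ℕₚ.≤-Reasoning
      shuffle : ∀ r c t → r * c * t ≡ c * (r * t)
      shuffle = solve-∀

      perVertex : ∀ y → 𝟙 (all (adj G y) X) * extensions G (y ∷ X) k ≤
                  ∑ (cliques G r) (λ S → 𝟙 (all (lookup S) (y ∷ X))) * r ^ k
      perVertex y with all (adj G y) X in y~
      ... | false = z≤n
      ... | true  = ℕₚ.≤-trans (ℕₚ.≤-reflexive (ℕₚ.*-identityˡ _))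
        (extensions-upper r k (y ∷ X) (trans (sym (ℕₚ.+-suc (length X) k)) |X|)
          (All.tabulate (all-true⁻ (adj G y) X y~) ∷ X~))

      𝟙-∧ : ∀ a b → 𝟙 (a ∧ b) ≡ 𝟙 a * 𝟙 b
      𝟙-∧ true  b = sym (ℕₚ.*-identityˡ (𝟙 b))
      𝟙-∧ false b = refl

      perClique : ∀ S → S ∈ cliques G r → ∑ (allFin n) (λ y → 𝟙 (all (lookup S) (y ∷ X))) ≡ r * 𝟙 (all (lookup S) X)
      perClique S S∈ =
        trans (∑-cong (allFin n) λ y → 𝟙-∧ (lookup S y) (all (lookup S) X))
          (trans (sym (*-distribʳ-∑ (𝟙 (all (lookup S) X)) (allFin n) (𝟙 ∘ lookup S)))
            (cong (_* 𝟙 (all (lookup S) X)) (trans (∑-lookup S) (card-cliques S∈))))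

    -- When `A` is the whole vertex set, the ordered edge is itself the start of a sequence: first
    -- `b`, then `a`, then the `k` further vertices. The total thus equals
    -- `extensions G [] (2 + k)`.
    totalExtensions-upper : ∀ k → totalExtensions G (allFin n) [] k ≤ copiesK G (2 + k) * (2 + k) ^ (2 + k)
    totalExtensions-upper k = begin
      ∑ (allFin n) (λ a → ∑ (allFin n) (edgeExtensions G [] k a))
        ≡⟨ ∑-swap (allFin n) (allFin n) _ ⟩
      ∑ (allFin n) (λ b → ∑ (allFin n) (λ a → edgeExtensions G [] k a b))
        ≡⟨ ∑-cong (allFin n) (λ b → trans (∑-cong (allFin n) λ a → cong (λ t → 𝟙 t * extensions G (a ∷ b ∷ []) k) (sym (∧-identityʳ (adj G a b))))
                                           (sym (ℕₚ.*-identityˡ _))) ⟩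
      extensions G [] (2 + k)
        ≤⟨ extensions-upper (2 + k) (2 + k) [] refl [] ⟩
      ∑ (cliques G (2 + k)) (λ _ → 1) * (2 + k) ^ (2 + k)
        ≡⟨ cong (_* (2 + k) ^ (2 + k)) (trans (∑-const (cliques G (2 + k)) 1) (ℕₚ.*-identityʳ (copiesK G (2 + k)))) ⟩
      copiesK G (2 + k) * (2 + k) ^ (2 + k)
        ∎
      where open ℕₚ.≤-Reasoning

  -- Deleting the edges that lie in many copies of K_r

  -- `h` may be asymmetric, so an edge is deleted as soon as one orientation is marked.
  removeEdges : ∀ {n} → Graph n → (Fin n → Fin n → Bool) → Graph n
  removeEdges G h .adj i j      = adj G i j ∧ not (h i j ∨ h j i)
  removeEdges G h .Graph.sym i j = cong₂ _∧_ (Graph.sym G i j) (cong not (∨-comm (h i j) (h j i)))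
  removeEdges G h .irrefl i rewrite irrefl G i = refl

  -- A deleted edge is charged to `h i j` and `h j i` together; forgetting the order of `i` and `j`
  -- then gives the factor 2.
  removedEdges-removeEdges : ∀ {n} (G : Graph n) h →
    removedEdges G (removeEdges G h) ≤ 2 * (∑[ i ∈ allFin n ] ∑[ j ∈ allFin n ] 𝟙 (h i j))
  removedEdges-removeEdges {n} G h = begin
    removedEdges G (removeEdges G h)
      ≡⟨ ∑-cong (allFin n) (λ i → length-filterᵇ _ (allFin n)) ⟩
    ∑ (allFin n) (λ i → ∑ (allFin n) (λ j → 𝟙 ((toℕ i <ᵇ toℕ j) ∧ adj G i j ∧ not (adj G i j ∧ not (h i j ∨ h j i)))))
      ≤⟨ ∑-mono (allFin n) (λ i → ∑-mono (allFin n) λ j → pair (toℕ i <ᵇ toℕ j) (adj G i j) (h i j) (h j i)) ⟩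
    ∑ (allFin n) (λ i → ∑ (allFin n) (λ j → 𝟙 (h i j) + 𝟙 (h j i)))
      ≡⟨ ∑-cong (allFin n) (λ i → ∑-distrib-+ (allFin n) _ _) ⟩
    ∑ (allFin n) (λ i → ∑ (allFin n) (λ j → 𝟙 (h i j)) + ∑ (allFin n) (λ j → 𝟙 (h j i)))
      ≡⟨ ∑-distrib-+ (allFin n) _ _ ⟩
    m + ∑ (allFin n) (λ i → ∑ (allFin n) (λ j → 𝟙 (h j i)))
      ≡⟨ cong (m +_) (∑-swap (allFin n) (allFin n) _) ⟩
    m + m
      ≡⟨ cong (m +_) (ℕₚ.+-identityʳ m) ⟨
    2 * m
      ∎
    where
    open ℕₚ.≤-Reasoning
    m = ∑ (allFin n) (λ i → ∑ (allFin n) (λ j → 𝟙 (h i j)))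
    pair : ∀ a b c d → 𝟙 (a ∧ b ∧ not (b ∧ not (c ∨ d))) ≤ 𝟙 c + 𝟙 d
    pair false b     c     d     = z≤n
    pair true  false c     d     = z≤n
    pair true  true  true  d     = s≤s z≤n
    pair true  true  false true  = s≤s z≤n
    pair true  true  false false = z≤n

  copiesK≡0 : ∀ {n} (H : Graph n) r →
    (∀ S → card S ≡ r → isClique H S ≡ true → ⊥) → copiesK H r ≡ 0
  copiesK≡0 {n} H r noClique with cliques H r in eq
  ... | []    = refl
  ... | S ∷ _ = ⊥-elim (noClique S (card-cliques H S∈) (proj₂ (∧-true⁻ (filterᵇ-∈⁻ (isCliqueOfSize H r) (allSubsets n) S∈))))
    where
    S∈ : S ∈ cliques H r
    S∈ = subst (S ∈_) (sym eq) (here refl)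

  -- With `s = 3 + 2q` and `r = 3 + q`: 2 for the orientations, `s ^ q` from the swaps, `r * r` from
  -- averaging over the ordered pairs of a clique, `r ^ r` from the sequences per copy.
  removalConstant : ℕ → ℕ
  removalConstant q = 2 * ((3 + 2 * q) ^ q * ((3 + q) * (3 + q)) * (3 + q) ^ (3 + q))

  removal : ∀ {n} (G : Graph n) q u v .{{_ : NonZero n}} .{{_ : NonZero u}} .{{_ : NonZero v}} →
    (∀ x → (3 + 2 * q) * v * nondegree G x + u * (3 + 2 * q) * n ≤ 2 * v * n) →
    ∃[ H ] H ⊆G G × u * n ^ suc q * removedEdges G H ≤ removalConstant q * v * copiesK G (3 + q)
           × copiesK H (3 + q) ≡ 0
  removal {n} G q u v bound = H , (λ i j → proj₁ ∘ ∧-true⁻) , few-removed , copiesK≡0 H r noClique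
    where
    s = 3 + 2 * q
    r = 3 + q
    T = u * n ^ suc q
    c = v * s ^ q * (r * r)

    -- The threshold `T / c` is the average over the `r * r` ordered pairs of an r-clique that
    -- `many-extensions` guarantees.
    heavy : Fin n → Fin n → Bool
    heavy a b = T ≤ᵇ c * edgeExtensions G [] (suc q) a b

    H : Graph n
    H = removeEdges G heavy

    heavy⇒≤ : ∀ a b → heavy a b ≡ true → T ≤ c * edgeExtensions G [] (suc q) a b
    heavy⇒≤ a b h = ℕₚ.≤ᵇ⇒≤ T _ (Equivalence.from T-≡ h)

    -- Markov's inequality over all ordered pairs: each heavy pair takes up at least `T` of `c`
    -- times the total, and the total is bounded by the number of copies.
    few-removed : T * removedEdges G H ≤ removalConstant q * v * copiesK G r
    few-removed = begin
      T * removedEdges G H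
        ≤⟨ ℕₚ.*-monoʳ-≤ T (removedEdges-removeEdges G heavy) ⟩
      T * (2 * ∑ (allFin n) (λ a → ∑ (allFin n) (λ b → 𝟙 (heavy a b))))
        ≡⟨ shuffle T (∑ (allFin n) (λ a → ∑ (allFin n) (λ b → 𝟙 (heavy a b)))) ⟩
      2 * (T * ∑ (allFin n) (λ a → ∑ (allFin n) (λ b → 𝟙 (heavy a b))))
        ≡⟨ cong (2 *_) (distribute T (λ a b → 𝟙 (heavy a b))) ⟩
      2 * ∑ (allFin n) (λ a → ∑ (allFin n) (λ b → T * 𝟙 (heavy a b)))
        ≤⟨ ℕₚ.*-monoʳ-≤ 2 (∑-mono (allFin n) λ a → ∑-mono (allFin n) λ b → markov a b) ⟩
      2 * ∑ (allFin n) (λ a → ∑ (allFin n) (λ b → c * edgeExtensions G [] (suc q) a b))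
        ≡⟨ cong (2 *_) (distribute c (edgeExtensions G [] (suc q))) ⟨
      2 * (c * totalExtensions G (allFin n) [] (suc q))
        ≤⟨ ℕₚ.*-monoʳ-≤ 2 (ℕₚ.*-monoʳ-≤ c (totalExtensions-upper G (suc q))) ⟩
      2 * (c * (copiesK G r * r ^ r))
        ≡⟨ regroup v (s ^ q) (r * r) (copiesK G r) (r ^ r) ⟩
      removalConstant q * v * copiesK G r
        ∎
      where
      open ℕₚ.≤-Reasoning
      shuffle : ∀ t x → t * (2 * x) ≡ 2 * (t * x)
      shuffle = solve-∀
      regroup : ∀ v a b k d → 2 * (v * a * b * (k * d)) ≡ 2 * (a * b * d) * v * k
      regroup = solve-∀
      distribute : ∀ t (f : Fin n → Fin n → ℕ) → t * ∑ (allFin n) (λ a → ∑ (allFin n) (f a))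
                   ≡ ∑ (allFin n) (λ a → ∑ (allFin n) (λ b → t * f a b))
      distribute t f = trans (*-distribˡ-∑ t (allFin n) _) (∑-cong (allFin n) λ a → *-distribˡ-∑ t (allFin n) (f a))
      markov : ∀ a b → T * 𝟙 (heavy a b) ≤ c * edgeExtensions G [] (suc q) a b
      markov a b with heavy a b in h
      ... | false = ℕₚ.≤-trans (ℕₚ.≤-reflexive (ℕₚ.*-zeroʳ T)) z≤n
      ... | true  = ℕₚ.≤-trans (ℕₚ.≤-reflexive (ℕₚ.*-identityʳ T)) (heavy⇒≤ a b h)

    -- A positive threshold excludes the diagonal pairs, which have no extensions, from being heavy.
    0<T : 0 < T
    0<T = ℕₚ.*-mono-≤ {1} {u} {1} (ℕ.>-nonZero⁻¹ u) (ℕ.>-nonZero⁻¹ (n ^ suc q) {{ℕₚ.m^n≢0 n (suc q)}})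

    in-H⇒not-heavy : ∀ {a b} → adj H a b ≡ true → heavy a b ≡ true → ⊥
    in-H⇒not-heavy {a} {b} ab h =
      contradiction (trans (sym (cong (λ t → not (t ∨ heavy b a)) h)) (proj₂ (∧-true⁻ {adj G a b} ab))) λ ()

    -- A clique of `H` is a clique of `G`, so `many-extensions` applies with `X` empty. The nested
    -- sum is shaped for averaging one endpoint at a time.
    enough : ∀ S → length (elements S) ≡ r → isClique H S ≡ true →
      length (elements S) * (r * T) ≤ ∑[ a ∈ elements S ] c * ∑ (elements S) (edgeExtensions G [] (suc q) a)
    enough S |A| clique = begin
      length (elements S) * (r * T)                                 ≡⟨ cong (_* (r * T)) |A| ⟩
      r * (r * T)                                                   ≡⟨ ℕₚ.*-assoc r r T ⟨
      r * r * T                                                     ≤⟨ ℕₚ.*-monoʳ-≤ (r * r) (many-extensions G s u v bound q 0 (elements S) [] |A| refl (sym (ℕₚ.+-identityʳ s)) (AllPairs.map (proj₁ ∘ ∧-true⁻) (elements-clique H S clique))) ⟩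
      r * r * (v * s ^ q * totalExtensions G (elements S) [] (suc q))  ≡⟨ shuffle (r * r) (v * s ^ q) _ ⟩
      c * totalExtensions G (elements S) [] (suc q)                 ≡⟨ *-distribˡ-∑ c (elements S) _ ⟩
      ∑ (elements S) (λ a → c * ∑ (elements S) (edgeExtensions G [] (suc q) a))  ∎
      where
      open ℕₚ.≤-Reasoning
      shuffle : ∀ a b w → a * (b * w) ≡ b * a * w
      shuffle = solve-∀

    noClique : ∀ S → card S ≡ r → isClique H S ≡ true → ⊥
    noClique S |S| clique
      with |A| ← trans (length-elements S) |S|
      -- Averaging over the first endpoint and then over the second yields a heavy pair inside the
      -- clique.
      with a , a∈ , Ta ← ∑-average (elements S) _ (r * T) (subst (0 <_) (sym |A|) (s≤s z≤n)) (enough S |A| clique)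
      with b , b∈ , Tab ← ∑-average (elements S) _ T (subst (0 <_) (sym |A|) (s≤s z≤n))
                           (subst₂ _≤_ (cong (_* T) (sym |A|)) (*-distribˡ-∑ c (elements S) (edgeExtensions G [] (suc q) a)) Ta)
      with a ≟ b
    ... | yes refl = contradiction
      (ℕₚ.≤-trans Tab (ℕₚ.≤-reflexive (trans (cong (λ t → c * (𝟙 t * extensions G (a ∷ a ∷ []) (suc q))) (irrefl G a)) (ℕₚ.*-zeroʳ c))))
      (ℕₚ.<⇒≱ 0<T)
    ... | no a≢b = in-H⇒not-heavy
      (isClique⁻ H S clique (filterᵇ-∈⁻ (lookup S) (allFin n) a∈) (filterᵇ-∈⁻ (lookup S) (allFin n) b∈) a≢b)
      (Equivalence.to T-≡ (ℕₚ.≤⇒≤ᵇ Tab))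

  -- Arithmetic of the degree and copy bounds, with denominators cleared

  bound-nondegree : ∀ q v u n d d̄ → d + d̄ ≡ n →
    ((1 + 2 * q) * v + u * (3 + 2 * q)) * n ≤ d * ((3 + 2 * q) * v) →
    (3 + 2 * q) * v * d̄ + u * (3 + 2 * q) * n ≤ 2 * v * n
  -- The numerator 2 arises as `(3 + 2 * q) - (1 + 2 * q)`; the subtracted term is added to both
  -- sides.
  bound-nondegree q v u n d d̄ refl le = ℕₚ.+-cancelʳ-≤ ((1 + 2 * q) * v * (d + d̄)) _ _ (begin
    (3 + 2 * q) * v * d̄ + u * (3 + 2 * q) * n + (1 + 2 * q) * v * n    ≡⟨ regroup q u v d̄ n ⟩
    (3 + 2 * q) * v * d̄ + ((1 + 2 * q) * v + u * (3 + 2 * q)) * n      ≤⟨ ℕₚ.+-monoʳ-≤ _ le ⟩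
    (3 + 2 * q) * v * d̄ + d * ((3 + 2 * q) * v)                        ≡⟨ split q v d d̄ ⟩
    2 * v * n + (1 + 2 * q) * v * n                                    ∎)
    where
    open ℕₚ.≤-Reasoning
    regroup : ∀ q u v d̄ n → (3 + 2 * q) * v * d̄ + u * (3 + 2 * q) * n + (1 + 2 * q) * v * n
              ≡ (3 + 2 * q) * v * d̄ + ((1 + 2 * q) * v + u * (3 + 2 * q)) * n
    regroup = solve-∀
    split : ∀ q v d d̄ → (3 + 2 * q) * v * d̄ + d * ((3 + 2 * q) * v)
            ≡ 2 * v * (d + d̄) + (1 + 2 * q) * v * (d + d̄)
    split = solve-∀

  -- Here α is `u/v` and ε is `e/f`. Both hypotheses share the factor `u * n ^ suc q`, and
  -- strictness lets it be cancelled without a proof that it is nonzero.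
  few-removed⇒ : ∀ q u v e f n C R →
    u * n ^ suc q * R ≤ removalConstant q * v * C →
    C * (suc (removalConstant q) * v * f) < u * e * n ^ (3 + q) →
    R * f ≤ e * n ^ 2
  few-removed⇒ q u v e f n C R removed few = ℕₚ.<⇒≤ (ℕₚ.*-cancelˡ-< (u * n ^ suc q) _ _ (begin-strict
    u * n ^ suc q * (R * f)                    ≡⟨ ℕₚ.*-assoc (u * n ^ suc q) R f ⟨
    u * n ^ suc q * R * f                      ≤⟨ ℕₚ.*-monoˡ-≤ f removed ⟩
    removalConstant q * v * C * f              ≤⟨ ℕₚ.m≤n+m _ (v * C * f) ⟩
    v * C * f + removalConstant q * v * C * f  ≡⟨ regroup (removalConstant q) v C f ⟩
    C * (suc (removalConstant q) * v * f)      <⟨ few ⟩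
    u * e * n ^ (3 + q)                        ≡⟨ powers u e n (n ^ q) ⟩
    u * n ^ suc q * (e * n ^ 2)                ∎))
    where
    open ℕₚ.≤-Reasoning
    regroup : ∀ m v c f → v * c * f + m * v * c * f ≡ c * ((1 + m) * v * f)
    regroup = solve-∀
    powers : ∀ u e n t → u * e * (n * (n * (n * t))) ≡ u * (n * t) * (e * (n * (n * 1)))
    powers = solve-∀

open import Data.Integer as ℤ using (+_; -[1+_])
import Data.Integer.Properties as ℤₚ
open import Data.Rational using (ℚ; mkℚ; 0ℚ; _+_; _*_; _/_; *<*; toℚᵘ) renaming (_≤_ to _≤ℚ_; _<_ to _<ℚ_)
open import Data.Rational.Properties using (toℚᵘ-homo-+; toℚᵘ-homo-*; toℚᵘ-mono-≤; toℚᵘ-mono-<; toℚᵘ-cancel-≤; toℚᵘ-fromℚᵘ; positive⁻¹; normalize-pos)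
open import Data.Rational.Unnormalised as ℚᵘ using (mkℚᵘ)
import Data.Rational.Unnormalised.Properties as ℚᵘₚ

-- Translation of the rational inequalities

infix 4 _≈_/suc_

-- A record rather than an alias, so that unification recovers x, a and b without normalising.
record _≈_/suc_ (x : ℚ) (a b : ℕ) : Set where
  constructor ⟨_⟩
  field ≃-fraction : toℚᵘ x ℚᵘ.≃ mkℚᵘ (+ a) b

open _≈_/suc_

module _ {x y : ℚ} {a b c d : ℕ} (x≈′ : x ≈ a /suc b) (y≈′ : y ≈ c /suc d) where

  private
    x≈ = ≃-fraction x≈′
    y≈ = ≃-fraction y≈′

  -- The index `d + b * suc d` is the predecessor of `suc b * suc d`, since `mkℚᵘ` stores the
  -- denominator minus one.
  ≈-+ : x + y ≈ a ℕ.* suc d ℕ.+ c ℕ.* suc b /suc (d ℕ.+ b ℕ.* suc d)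
  ≈-+ = ⟨_⟩ (ℚᵘₚ.≃-trans (toℚᵘ-homo-+ x y) (ℚᵘₚ.≃-trans (ℚᵘₚ.+-cong x≈ y≈)
    (ℚᵘₚ.≃-reflexive (cong (λ z → mkℚᵘ z (d ℕ.+ b ℕ.* suc d))
      (cong₂ ℤ._+_ (sym (ℤₚ.pos-* a (suc d))) (sym (ℤₚ.pos-* c (suc b))))))))

  ≈-* : x * y ≈ a ℕ.* c /suc (d ℕ.+ b ℕ.* suc d)
  ≈-* = ⟨_⟩ (ℚᵘₚ.≃-trans (toℚᵘ-homo-* x y) (ℚᵘₚ.≃-trans (ℚᵘₚ.*-cong x≈ y≈)
    (ℚᵘₚ.≃-reflexive (cong (λ z → mkℚᵘ z (d ℕ.+ b ℕ.* suc d)) (sym (ℤₚ.pos-* a c))))))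

  ≤⇒*≤* : x ≤ℚ y → a ℕ.* suc d ≤ c ℕ.* suc b
  ≤⇒*≤* x≤y = ℤₚ.drop‿+≤+ (subst₂ ℤ._≤_ (sym (ℤₚ.pos-* a (suc d))) (sym (ℤₚ.pos-* c (suc b)))
    (ℚᵘₚ.drop-*≤* (ℚᵘₚ.≤-respˡ-≃ x≈ (ℚᵘₚ.≤-respʳ-≃ y≈ (toℚᵘ-mono-≤ x≤y)))))

  *≤*⇒≤ : a ℕ.* suc d ≤ c ℕ.* suc b → x ≤ℚ y
  *≤*⇒≤ le = toℚᵘ-cancel-≤ (ℚᵘₚ.≤-respˡ-≃ (ℚᵘₚ.≃-sym x≈) (ℚᵘₚ.≤-respʳ-≃ (ℚᵘₚ.≃-sym y≈)
    (ℚᵘ.*≤* (subst₂ ℤ._≤_ (ℤₚ.pos-* a (suc d)) (ℤₚ.pos-* c (suc b)) (ℤ.+≤+ le)))))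

  <⇒*<* : x <ℚ y → a ℕ.* suc d < c ℕ.* suc b
  <⇒*<* x<y = ℤₚ.drop‿+<+ (subst₂ ℤ._<_ (sym (ℤₚ.pos-* a (suc d))) (sym (ℤₚ.pos-* c (suc b)))
    (ℚᵘₚ.drop-*<* (ℚᵘₚ.<-respˡ-≃ x≈ (ℚᵘₚ.<-respʳ-≃ y≈ (toℚᵘ-mono-< x<y)))))

/-≈ : ∀ a b → + a / suc b ≈ a /suc b
/-≈ a b = ⟨ toℚᵘ-fromℚᵘ (mkℚᵘ (+ a) b) ⟩

ℕtoℚ-≈ : ∀ m → ℕtoℚ m ≈ m /suc 0
ℕtoℚ-≈ m = /-≈ m 0

-- A numerator of the form `suc a` supplies the `NonZero` instance that `removal` requires for α.
positive-≈ : ∀ x → 0ℚ <ℚ x → ∃[ a ] ∃[ b ] x ≈ suc a /suc b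
positive-≈ (mkℚ (+ suc a) b _)   _           = a , b , ⟨ ℚᵘₚ.≃-refl ⟩
positive-≈ (mkℚ (+ zero) b _)    (*<* 0<0)   = contradiction 0<0 (ℤₚ.<-irrefl refl)
positive-≈ (mkℚ -[1+ a ] b _)    (*<* ())

degree-bound : ∀ q n d {α u v} → α ≈ u /suc v → (threshold (3 ℕ.+ q) + α) * ℕtoℚ n ≤ℚ ℕtoℚ d →
  ((1 ℕ.+ 2 ℕ.* q) ℕ.* suc v ℕ.+ u ℕ.* (3 ℕ.+ 2 ℕ.* q)) ℕ.* n ≤ d ℕ.* ((3 ℕ.+ 2 ℕ.* q) ℕ.* suc v)
degree-bound q n d {u = u} {v} α≈ le = subst₂ _≤_
  (ℕₚ.*-identityʳ (((1 ℕ.+ 2 ℕ.* q) ℕ.* suc v ℕ.+ u ℕ.* (3 ℕ.+ 2 ℕ.* q)) ℕ.* n))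
  (cong (d ℕ.*_) (ℕₚ.*-identityʳ ((3 ℕ.+ 2 ℕ.* q) ℕ.* suc v)))
  (≤⇒*≤* (≈-* (≈-+ (/-≈ (1 ℕ.+ 2 ℕ.* q) (2 ℕ.+ 2 ℕ.* q)) α≈) (ℕtoℚ-≈ n)) (ℕtoℚ-≈ d) le)

copies-bound : ∀ c m N {μ α ε u v e f} → μ ≈ 1 /suc m → α ≈ u /suc v → ε ≈ e /suc f →
  ℕtoℚ c <ℚ μ * α * ε * ℕtoℚ N → c ℕ.* (suc m ℕ.* suc v ℕ.* suc f) < u ℕ.* e ℕ.* N
copies-bound c m N {u = u} {v} {e} {f} μ≈ α≈ ε≈ lt = subst₂ _<_
  (cong (c ℕ.*_) (ℕₚ.*-identityʳ (suc m ℕ.* suc v ℕ.* suc f)))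
  (trans (ℕₚ.*-identityʳ (1 ℕ.* u ℕ.* e ℕ.* N)) (cong (λ t → t ℕ.* e ℕ.* N) (ℕₚ.*-identityˡ u)))
  (<⇒*<* (ℕtoℚ-≈ c) (≈-* (≈-* (≈-* μ≈ α≈) ε≈) (ℕtoℚ-≈ N)) lt)

removed-bound : ∀ R N {ε e f} → ε ≈ e /suc f → R ℕ.* suc f ≤ e ℕ.* N → ℕtoℚ R ≤ℚ ε * ℕtoℚ N
removed-bound R N {e = e} {f} ε≈ le = *≤*⇒≤ (ℕtoℚ-≈ R) (≈-* ε≈ (ℕtoℚ-≈ N))
  (subst₂ _≤_ (cong (R ℕ.*_) (sym (ℕₚ.*-identityʳ (suc f)))) (sym (ℕₚ.*-identityʳ (e ℕ.* N))) le)

theorem1p2 : ∀ (r : ℕ) → 3 ≤ r →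
    ∃[ μ ] (0ℚ <ℚ μ ×
    (∀ (α ε : ℚ) → 0ℚ <ℚ α → 0ℚ <ℚ ε →
    ∀ (n : ℕ) (G : Graph n) →
    (∀ v → (threshold r + α) * ℕtoℚ n ≤ℚ ℕtoℚ (degree G v)) →
    ℕtoℚ (copiesK G r) <ℚ μ * α * ε * ℕtoℚ (n ^ r) →
    ∃[ H ] (H ⊆G G × ℕtoℚ (removedEdges G H) ≤ℚ ε * ℕtoℚ (n ^ 2) × copiesK H r ≡ 0)))
theorem1p2 1 (s≤s ())
theorem1p2 2 (s≤s (s≤s ()))
theorem1p2 (suc (suc (suc q))) _ =
  -- The successor makes the denominator of μ visibly nonzero; `few-removed⇒` discards the slack.
  + 1 / suc m , positive⁻¹ _ {{normalize-pos 1 (suc m)}} ,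
  λ α ε 0<α 0<ε → main (/-≈ 1 m) (positive-≈ α 0<α) (positive-≈ ε 0<ε)
  where
  m = removalConstant q
  r = 3 ℕ.+ q

  main : ∀ {μ α ε} → μ ≈ 1 /suc m → ∃[ u ] ∃[ v ] α ≈ suc u /suc v → ∃[ e ] ∃[ f ] ε ≈ suc e /suc f →
    ∀ n (G : Graph n) →
    (∀ x → (threshold r + α) * ℕtoℚ n ≤ℚ ℕtoℚ (degree G x)) →
    ℕtoℚ (copiesK G r) <ℚ μ * α * ε * ℕtoℚ (n ^ r) →
    ∃[ H ] (H ⊆G G × ℕtoℚ (removedEdges G H) ≤ℚ ε * ℕtoℚ (n ^ 2) × copiesK H r ≡ 0)
  -- For `n = 0` the copy bound would place a natural number strictly below 0; `removal` needs `n`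
  -- nonzero.
  main μ≈ (u , v , α≈) (e , f , ε≈) zero G degrees few = contradiction
    (ℕₚ.<-≤-trans (copies-bound (copiesK G r) m 0 μ≈ α≈ ε≈ few) (ℕₚ.≤-reflexive (ℕₚ.*-zeroʳ (suc u ℕ.* suc e))))
    ℕₚ.n≮0
  main μ≈ (u , v , α≈) (e , f , ε≈) n@(suc _) G degrees few =
    let H , H⊆G , removed , free = removal G q (suc u) (suc v) λ x →
          bound-nondegree q (suc v) (suc u) n (degree G x) (nondegree G x) (degree+nondegree G x)
            (degree-bound q n (degree G x) α≈ (degrees x))
    in H , H⊆G ,
       removed-bound (removedEdges G H) (n ^ 2) ε≈
         (few-removed⇒ q (suc u) (suc v) (suc e) (suc f) n (copiesK G r) (removedEdges G H) removed
           (copies-bound (copiesK G r) m (n ^ r) μ≈ α≈ ε≈ few)) ,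
       free
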